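{- Let $(\bar{\boldsymbol{x}},\bar{\boldsymbol{y}})$ be the solution obtained by solving $\mathbf{CP}$ and then $\mathbf{EP}$ (with power demand $d_t(\bar x(t))$) in sequence, and let $(\boldsymbol{x}^*,\boldsymbol{y}^*)$ be an optimal solution of the joint problem $\mathbf{DCM}$. The factor loss in optimality $$\rho\triangleq\max_{\text{all inputs}}\frac{\mathrm{C_{DCM}}(\bar{\boldsymbol{x}},\bar{\boldsymbol{y}})}{\mathrm{C_{DCM}}(\boldsymbol{x}^*,\boldsymbol{y}^*)}$$ is given by $$\rho=\frac{LP_{\max}}{Lc_o+c_m},$$ and it is tight (there exists an input to $\mathbf{DCM}$ for which the ratio $\mathrm{C_{DCM}}(\bar{\boldsymbol{x}},\bar{\boldsymbol{y}})/\mathrm{C_{DCM}}(\boldsymbol{x}^*,\boldsymbol{y}^*)$ equals $LP_{\max}/(Lc_o+c_m)$).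
   Context: Notation: $[z]^+=\max(0,z)$; $\mathbb{N}^0$ is the set of non-negative integers; bold symbols denote sequences over time, e.g. $\boldsymbol{x}=\langle x(t)\rangle_{t=1}^T$. Parameters: number of on-site generators $N$; generator capacity $L>0$; incremental generation cost $c_o\ge0$ per unit energy; sunk cost $c_m\ge0$ per active generator per slot, with $Lc_o+c_m>0$; generator startup cost $\beta_g>0$; server switching cost $\beta_s>0$; price bounds $0\le P_{\min}\le P_{\max}$; it is assumed that $c_o+c_m/L<P_{\max}$. An input consists of a time duration $T$, workload $a(t)\ge0$, grid prices $p(t)\in[P_{\min},P_{\max}]$, and total power consumption functions $g_t(x,a)\ge0$ that are increasing (non-decreasing) and convex in $x$ and $a$, for $1\le t\le T$. Put $d_t(x)=g_t(x,a(t))$. Define $$\psi(y,p,d)=\begin{cases} c_m y+p\,d, & p\le c_o,\\ c_m y+c_oLy+p(d-Ly), & p>c_o \text{ and } d>Ly,\\ c_m y+c_o d, & \text{otherwise.}\end{cases}$$ $\mathbf{DCM}$: minimize $$\mathrm{C_{DCM}}(\boldsymbol{x},\boldsymbol{y})=\sum_{t=1}^{T}\left\{\psi(y(t),p(t),d_t(x(t)))+\beta_s[x(t)-x(t-1)]^+ +\beta_g[y(t)-y(t-1)]^+\right\}$$ over $x(t),y(t)\in\mathbb{N}^0$ subject to $x(t)\ge a(t)$, $y(t)\le N$, $x(0)=y(0)=0$. $\mathbf{CP}$: minimize $\sum_{t=1}^{T}\{p(t)d_t(x(t))+\beta_s[x(t)-x(t-1)]^+\}$ over $x(t)\in\mathbb{N}^0$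 subject to $x(t)\ge a(t)$, $x(0)=0$. Its optimal solution is denoted $\bar{\boldsymbol{x}}$. $\mathbf{EP}$: given $\bar{\boldsymbol{x}}$, minimize $\sum_{t=1}^{T}\{\psi(y(t),p(t),d_t(\bar x(t)))+\beta_g[y(t)-y(t-1)]^+\}$ over $y(t)\in\mathbb{N}^0$ subject to $y(t)\le N$, $y(0)=0$. Its optimal solution is denoted $\bar{\boldsymbol{y}}$.
   Formalization: The maximum is replaced by a supremum, approached within every ε>0 but never attained: equality would force x*=y*=0 as startup and switching costs are positive. N≥1 is assumed, since for N=0 the ratio is always 1. Ratios are taken only when the optimal cost is positive. -}

module Defs where

open import Algebra.Bundles using (CommutativeRing)
import Algebra.Definitions.RawMonoid as RawMonoidDefinitions
open import Data.Bool.Base using (if_then_else_)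
open import Data.Fin.Base using (Fin; zero; suc; inject₁)
open import Data.Nat.Base as ℕ using (ℕ; _∸_)
open import Data.Product.Base using (_×_; _,_; ∃-syntax)
open import Data.Vec.Functional using (Vector)
open import Level using (Level; _⊔_) renaming (suc to lsuc)
open import Relation.Binary.Bundles using (DecTotalOrder)
open import Relation.Binary.Core using (Rel)
import Relation.Binary.Properties.DecTotalOrder as DecTotalOrderProperties
open import Relation.Binary.Structures using (IsDecTotalOrder)
open import Relation.Nullary.Decidable.Core using (does)
open import Relation.Nullary.Negation.Core using (¬_)

private
  variable
    ℓ ℓ′ : Level

-- The field of scalars.  The (classical) real numbers are an instance, and the
-- real numbers are used below only through these axioms.
record ArchimedeanOrderedField c ℓ₁ ℓ₂ : Set (lsuc (c ⊔ ℓ₁ ⊔ ℓ₂)) where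
  infix  4 _≤_
  infixl 7 _/_
  infix  8 _⁻¹

  field
    commutativeRing : CommutativeRing c ℓ₁

  open CommutativeRing commutativeRing public
  open RawMonoidDefinitions +-rawMonoid public using (sum) renaming (_×_ to _·_)

  field
    _≤_             : Rel Carrier ℓ₂
    isDecTotalOrder : IsDecTotalOrder _≈_ _≤_
    +-monoˡ-≤       : ∀ {x y} z → x ≤ y → x + z ≤ y + z
    *-nonNegative   : ∀ {x y} → 0# ≤ x → 0# ≤ y → 0# ≤ x * y
    0≉1             : ¬ (0# ≈ 1#)
    -- The value of 0# ⁻¹ is unconstrained.
    _⁻¹             : Carrier → Carrier
    *-inverseʳ      : ∀ x → ¬ (x ≈ 0#) → x * x ⁻¹ ≈ 1#
    archimedean     : ∀ x → ∃[ n ] x ≤ n · 1#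

  fromℕ : ℕ → Carrier
  fromℕ n = n · 1#

  decTotalOrder : DecTotalOrder c ℓ₁ ℓ₂
  decTotalOrder = record { isDecTotalOrder = isDecTotalOrder }

  open IsDecTotalOrder isDecTotalOrder public using (_≤?_)
  open DecTotalOrderProperties decTotalOrder public using (_<_)

  _/_ : Carrier → Carrier → Carrier
  x / y = x * y ⁻¹

  record IsSupremum {A : Set ℓ} (f : A → Carrier) (s : Carrier) :
                    Set (ℓ ⊔ c ⊔ ℓ₂) where
    field
      upperBound : ∀ x → f x ≤ s
      least      : ∀ u → (∀ x → f x ≤ u) → s ≤ u

  record IsMinimiser {A : Set ℓ} (Feasible : A → Set ℓ′) (cost : A → Carrier)
                     (x : A) : Set (ℓ ⊔ ℓ′ ⊔ ℓ₂) where
    field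
      feasible : Feasible x
      minimal  : ∀ x′ → Feasible x′ → cost x ≤ cost x′

-- The sequence t ↦ x(t-1), with x(0) = 0; slot t ∈ {1,…,T} is the t-th element
-- of Fin T.
previous : ∀ {T} → Vector ℕ T → Vector ℕ T
previous x zero    = 0
previous x (suc t) = x (inject₁ t)

module _ {c ℓ₁ ℓ₂} (F : ArchimedeanOrderedField c ℓ₁ ℓ₂) where

  open ArchimedeanOrderedField F

  record Parameters : Set (c ⊔ ℓ₁ ⊔ ℓ₂) where
    field
      N              : ℕ
      L cₒ cₘ βg βs  : Carrier
      Pmin Pmax      : Carrier
      -- Without generators the ratio below would always be 1.
      0<N            : 0 ℕ.< N
      0<L            : 0# < L
      0≤cₒ           : 0# ≤ cₒ
      0≤cₘ           : 0# ≤ cₘ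
      0<Lcₒ+cₘ       : 0# < L * cₒ + cₘ
      0<βg           : 0# < βg
      0<βs           : 0# < βs
      0≤Pmin         : 0# ≤ Pmin
      Pmin≤Pmax      : Pmin ≤ Pmax
      cₒ+cₘ/L<Pmax   : cₒ + cₘ / L < Pmax

module _ {c ℓ₁ ℓ₂} {F : ArchimedeanOrderedField c ℓ₁ ℓ₂} (P : Parameters F) where

  open ArchimedeanOrderedField F
  open Parameters P

  record Input : Set (c ⊔ ℓ₂) where
    field
      T          : ℕ
      a          : Vector Carrier T
      p          : Vector Carrier T
      g          : Fin T → Carrier → Carrier → Carrier
      0≤a        : ∀ t → 0# ≤ a t
      Pmin≤p     : ∀ t → Pmin ≤ p t
      p≤Pmax     : ∀ t → p t ≤ Pmax
      -- g t is a function of (x , a) on the quadrant x , a ≥ 0; its values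
      -- elsewhere are irrelevant.
      g-nonNeg   : ∀ t {x a} → 0# ≤ x → 0# ≤ a → 0# ≤ g t x a
      g-mono     : ∀ t {x x′ a a′} → 0# ≤ x → 0# ≤ a → x ≤ x′ → a ≤ a′ →
                   g t x a ≤ g t x′ a′
      g-convex   : ∀ t {θ x x′ a a′} → 0# ≤ θ → θ ≤ 1# →
                   0# ≤ x → 0# ≤ x′ → 0# ≤ a → 0# ≤ a′ →
                   g t (θ * x + (1# - θ) * x′) (θ * a + (1# - θ) * a′)
                     ≤ θ * g t x a + (1# - θ) * g t x′ a′

  ψ : ℕ → Carrier → Carrier → Carrier
  ψ y p d =
    if does (p ≤? cₒ) then
      cₘ * fromℕ y + p * d
    else if does (d ≤? L * fromℕ y) then
      cₘ * fromℕ y + cₒ * d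
    else
      cₘ * fromℕ y + cₒ * L * fromℕ y + p * (d - L * fromℕ y)

  module _ (I : Input) where

    open Input I

    d : Fin T → ℕ → Carrier
    d t x = g t (fromℕ x) (a t)

    -- Truncated subtraction on ℕ is [_]⁺ of the difference.
    increase : Vector ℕ T → Fin T → Carrier
    increase x t = fromℕ (x t ∸ previous x t)

    DCM-Feasible : Vector ℕ T × Vector ℕ T → Set ℓ₂
    DCM-Feasible (x , y) = (∀ t → a t ≤ fromℕ (x t)) × (∀ t → y t ℕ.≤ N)

    DCM-cost : Vector ℕ T × Vector ℕ T → Carrier
    DCM-cost (x , y) = sum λ t →
      ψ (y t) (p t) (d t (x t)) + βs * increase x t + βg * increase y t

    CP-Feasible : Vector ℕ T → Set ℓ₂
    CP-Feasible x = ∀ t → a t ≤ fromℕ (x t)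

    CP-cost : Vector ℕ T → Carrier
    CP-cost x = sum λ t → p t * d t (x t) + βs * increase x t

    EP-Feasible : Vector ℕ T → Set
    EP-Feasible y = ∀ t → y t ℕ.≤ N

    EP-cost : Vector ℕ T → Vector ℕ T → Carrier
    EP-cost x̄ y = sum λ t → ψ (y t) (p t) (d t (x̄ t)) + βg * increase y t

  -- An input with a sequential and a joint solution, chosen arbitrarily among
  -- the optimal ones, for which the ratio of costs is defined.
  record Instance : Set (c ⊔ ℓ₁ ⊔ ℓ₂) where
    field
      input        : Input

    open Input input using (T)

    field
      x̄ ȳ x* y*    : Vector ℕ T
      x̄-optimal    : IsMinimiser (CP-Feasible input) (CP-cost input) x̄
      ȳ-optimal    : IsMinimiser (EP-Feasible input) (EP-cost input x̄) ȳ
      x*y*-optimal : IsMinimiser (DCM-Feasible input) (DCM-cost input) (x* , y*)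
      0<cost*      : 0# < DCM-cost input (x* , y*)

  ratio : Instance → Carrier
  ratio i = DCM-cost input (x̄ , ȳ) / DCM-cost input (x* , y*)
    where open Instance i

  -- No instance attains the bound: equality would force x* = y* = 0 because
  -- βs , βg > 0, and the ratio would then be at most 1 < ρ.
  Tight : Carrier → Set (c ⊔ ℓ₁ ⊔ ℓ₂)
  Tight ρ = ∀ ε → 0# < ε → ∃[ i ] ρ - ε < ratio i

{-# OPTIONS --safe #-}
module Submission where

-- With K = L cₒ + cₘ and R = L Pmax, serving a demand costs at least K / R times
-- its price on the grid, and the grid-only cost CP is an upper bound for the
-- sequential solution; hence R / K bounds the ratio.
--
-- For tightness, n servers are requested once every m + 1 slots, at price Pmax
-- and power κ per server, where m Pmax κ = βs: leaving a server on between two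
-- bursts costs as much grid energy as restarting it.  CP may therefore switch
-- everything off and pay n βs per cycle.  The joint solution can instead keep
-- n servers on, fed by a single generator that runs at full capacity κ n ≈ L
-- and costs K per slot.  As n βs ≈ m R, the ratio of the costs per cycle is
-- about m R / ((m + 1) K), and for long horizons the initial switching is
-- negligible.

open import Defs
open import Data.Fin.Base as Fin using (Fin; zero; suc; inject₁; toℕ)
open import Data.Fin.Properties
  using (all?; finToFun-funToFin; remQuot-combine; toℕ-fromℕ<; toℕ-inject₁)
open import Data.List.Base using (allFin; filter)
import Data.List.Extrema as Extrema
open import Data.List.Membership.Propositional.Properties using (∈-allFin; ∈-filter⁺)
import Data.List.Relation.Unary.All as All
open import Data.List.Relation.Unary.All.Properties using (all-filter)
open import Data.Nat.Base as ℕ using (ℕ; zero; suc; z≤n; s≤s; _∸_; _⊓_)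
import Data.Nat.Properties as ℕ
open import Data.Product.Base using (_×_; _,_; ∃-syntax; proj₁; proj₂; map₂; uncurry)
open import Data.Sum.Base using (inj₁; inj₂)
open import Data.Vec.Functional using (Vector; _∷_)
open import Function.Base using (_∘_; case_of_)
open import Relation.Binary.Bundles using (DecTotalOrder)
import Relation.Binary.Properties.DecTotalOrder as DecTotalOrderProperties
open import Relation.Binary.PropositionalEquality.Core as ≡ using (_≡_; _≗_)
import Relation.Binary.Reasoning.PartialOrder
open import Relation.Nullary.Decidable.Core using (Dec; yes; no; _×-dec_)
open import Relation.Nullary.Negation.Core using (¬_; contradiction)

-- Arithmetic in Archimedean ordered fields.

module OrderedFieldProperties {c ℓ₁ ℓ₂} (F : ArchimedeanOrderedField c ℓ₁ ℓ₂) where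

  open ArchimedeanOrderedField F hiding (zero)
  open DecTotalOrder decTotalOrder public using (total; poset; totalOrder)
    renaming (refl to ≤-refl; reflexive to ≤-reflexive; trans to ≤-trans;
              antisym to ≤-antisym)
  open DecTotalOrderProperties decTotalOrder public
    using (≰⇒>; <⇒≱; ≤∧≉⇒<; <-trans)

  open import Algebra.Properties.Monoid.Mult +-monoid using (×-homo-+)
  open import Algebra.Properties.Semiring.Mult semiring public using (×1-homo-*)
  open import Algebra.Properties.Ring ring using (-1*x≈-x; -‿involutive)
  open import Algebra.Properties.Monoid.Sum +-monoid public
    using (sum-cong-≋; sum-cong-≗)
  open import Algebra.Properties.CommutativeMonoid.Sum +-commutativeMonoid public
    using (∑-distrib-+)
  open import Algebra.Properties.Semiring.Sum semiring public using (*-distribˡ-sum)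
  open import Algebra.Solver.Ring.NaturalCoefficients.Default commutativeSemiring public
    using (solve; _:=_; _:+_; _:*_; con)

  module ≤-Reasoning = Relation.Binary.Reasoning.PartialOrder poset
  open ≤-Reasoning

  +-monoʳ-≤ : ∀ {x y} z → x ≤ y → z + x ≤ z + y
  +-monoʳ-≤ {x} {y} z x≤y = begin
    z + x ≈⟨ +-comm z x ⟩
    x + z ≤⟨ +-monoˡ-≤ z x≤y ⟩
    y + z ≈⟨ +-comm y z ⟩
    z + y ∎

  +-mono-≤ : ∀ {x y u v} → x ≤ y → u ≤ v → x + u ≤ y + v
  +-mono-≤ x≤y u≤v = ≤-trans (+-monoˡ-≤ _ x≤y) (+-monoʳ-≤ _ u≤v)

  +-nonNegative : ∀ {x y} → 0# ≤ x → 0# ≤ y → 0# ≤ x + y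
  +-nonNegative 0≤x 0≤y = ≤-trans (≤-reflexive (sym (+-identityˡ 0#))) (+-mono-≤ 0≤x 0≤y)

  x≤x+y : ∀ {x y} → 0# ≤ y → x ≤ x + y
  x≤x+y {x} {y} 0≤y = begin
    x      ≈⟨ +-identityʳ x ⟨
    x + 0# ≤⟨ +-monoʳ-≤ x 0≤y ⟩
    x + y  ∎

  x≤y+x : ∀ {x y} → 0# ≤ y → x ≤ y + x
  x≤y+x 0≤y = ≤-trans (x≤x+y 0≤y) (≤-reflexive (+-comm _ _))

  x+[y-x]≈y : ∀ x y → x + (y - x) ≈ y
  x+[y-x]≈y x y = begin-equality
    x + (y - x)   ≈⟨ +-congˡ (+-comm y (- x)) ⟩
    x + (- x + y) ≈⟨ +-assoc x (- x) y ⟨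
    x - x + y     ≈⟨ +-congʳ (-‿inverseʳ x) ⟩
    0# + y        ≈⟨ +-identityˡ y ⟩
    y             ∎

  x≈y-[y-x] : ∀ x y → x ≈ y - (y - x)
  x≈y-[y-x] x y = begin-equality
    x                         ≈⟨ +-identityʳ x ⟨
    x + 0#                    ≈⟨ +-congˡ (-‿inverseʳ (y - x)) ⟨
    x + ((y - x) - (y - x))   ≈⟨ +-assoc _ _ _ ⟨
    x + (y - x) - (y - x)     ≈⟨ +-congʳ (x+[y-x]≈y x y) ⟩
    y - (y - x)               ∎

  +-cancelʳ-≤ : ∀ {x y} z → x + z ≤ y + z → x ≤ y
  +-cancelʳ-≤ {x} {y} z x+z≤y+z = begin
    x           ≈⟨ cancel x ⟨
    x + z - z   ≤⟨ +-monoˡ-≤ (- z) x+z≤y+z ⟩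
    y + z - z   ≈⟨ cancel y ⟩
    y           ∎
    where
    cancel : ∀ u → u + z - z ≈ u
    cancel u = trans (+-assoc u z (- z)) (trans (+-congˡ (-‿inverseʳ z)) (+-identityʳ u))

  x≤y⇒0≤y-x : ∀ {x y} → x ≤ y → 0# ≤ y - x
  x≤y⇒0≤y-x {x} {y} x≤y = begin
    0#    ≈⟨ -‿inverseʳ x ⟨
    x - x ≤⟨ +-monoˡ-≤ (- x) x≤y ⟩
    y - x ∎

  *-monoˡ-≤ : ∀ {x y} z → 0# ≤ z → x ≤ y → z * x ≤ z * y
  *-monoˡ-≤ {x} {y} z 0≤z x≤y = begin
    z * x               ≤⟨ x≤x+y (*-nonNegative 0≤z (x≤y⇒0≤y-x x≤y)) ⟩
    z * x + z * (y - x) ≈⟨ distribˡ z x (y - x) ⟨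
    z * (x + (y - x))   ≈⟨ *-congˡ (x+[y-x]≈y x y) ⟩
    z * y               ∎

  *-monoʳ-≤ : ∀ {x y} z → 0# ≤ z → x ≤ y → x * z ≤ y * z
  *-monoʳ-≤ {x} {y} z 0≤z x≤y = begin
    x * z ≈⟨ *-comm x z ⟩
    z * x ≤⟨ *-monoˡ-≤ z 0≤z x≤y ⟩
    z * y ≈⟨ *-comm z y ⟩
    y * z ∎

  <⇒≤ : ∀ {x y} → x < y → x ≤ y
  <⇒≤ = proj₁

  0<x⇒x≉0 : ∀ {x} → 0# < x → ¬ x ≈ 0#
  0<x⇒x≉0 0<x = proj₂ 0<x ∘ sym

  x*x⁻¹*y≈y : ∀ {x} y → ¬ x ≈ 0# → x * x ⁻¹ * y ≈ y
  x*x⁻¹*y≈y y x≉0 = trans (*-congʳ (*-inverseʳ _ x≉0)) (*-identityˡ y)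

  x/y*y≈x : ∀ {x y} → ¬ y ≈ 0# → x / y * y ≈ x
  x/y*y≈x {x} {y} y≉0 = begin-equality
    x * y ⁻¹ * y ≈⟨ solve 3 (λ x y y′ → x :* y′ :* y := y :* y′ :* x) refl x y (y ⁻¹) ⟩
    y * y ⁻¹ * x ≈⟨ x*x⁻¹*y≈y x y≉0 ⟩
    x            ∎

  *-cancelˡ-≈ : ∀ {x y} z → ¬ z ≈ 0# → z * x ≈ z * y → x ≈ y
  *-cancelˡ-≈ {x} {y} z z≉0 zx≈zy = begin-equality
    x              ≈⟨ x*x⁻¹*y≈y x z≉0 ⟨
    z * z ⁻¹ * x   ≈⟨ swap x ⟩
    z ⁻¹ * (z * x) ≈⟨ *-congˡ zx≈zy ⟩
    z ⁻¹ * (z * y) ≈⟨ swap y ⟨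
    z * z ⁻¹ * y   ≈⟨ x*x⁻¹*y≈y y z≉0 ⟩
    y              ∎
    where
    swap : ∀ u → z * z ⁻¹ * u ≈ z ⁻¹ * (z * u)
    swap u = solve 3 (λ z z′ u → z :* z′ :* u := z′ :* (z :* u)) refl z (z ⁻¹) u

  *-cancelˡ-≤ : ∀ {x y} z → 0# < z → z * x ≤ z * y → x ≤ y
  *-cancelˡ-≤ {x} {y} z 0<z zx≤zy with total x y
  ... | inj₁ x≤y = x≤y
  ... | inj₂ y≤x = ≤-reflexive (*-cancelˡ-≈ z (0<x⇒x≉0 0<z)
                     (≤-antisym zx≤zy (*-monoˡ-≤ z (<⇒≤ 0<z) y≤x)))

  *-monoˡ-< : ∀ {x y} z → 0# < z → x < y → z * x < z * y
  *-monoˡ-< z 0<z x<y = ≰⇒> (<⇒≱ x<y ∘ *-cancelˡ-≤ z 0<z)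

  *-cancelˡ-< : ∀ {x y} z → 0# ≤ z → z * x < z * y → x < y
  *-cancelˡ-< z 0≤z zx<zy = ≰⇒> (<⇒≱ zx<zy ∘ *-monoˡ-≤ z 0≤z)

  +-monoˡ-< : ∀ {x y} z → x < y → x + z < y + z
  +-monoˡ-< z x<y = ≰⇒> (<⇒≱ x<y ∘ +-cancelʳ-≤ z)

  *-positive : ∀ {x y} → 0# < x → 0# < y → 0# < x * y
  *-positive {x} {y} 0<x 0<y = begin-strict
    0#     ≈⟨ zeroʳ x ⟨
    x * 0# <⟨ *-monoˡ-< x 0<x 0<y ⟩
    x * y  ∎

  0≤1 : 0# ≤ 1#
  0≤1 with total 0# 1#
  ... | inj₁ 0≤1 = 0≤1
  -- Otherwise minus one is non-negative, and 1 is its square.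
  ... | inj₂ 1≤0 = begin
    0#          ≤⟨ *-nonNegative 0≤-1 0≤-1 ⟩
    - 1# * - 1# ≈⟨ -1*x≈-x (- 1#) ⟩
    - - 1#      ≈⟨ -‿involutive 1# ⟩
    1#          ∎
    where
    0≤-1 : 0# ≤ - 1#
    0≤-1 = ≤-trans (x≤y⇒0≤y-x 1≤0) (≤-reflexive (+-identityˡ (- 1#)))

  0<1 : 0# < 1#
  0<1 = ≤∧≉⇒< 0≤1 0≉1

  x<1+x : ∀ x → x < 1# + x
  x<1+x x = begin-strict
    x      ≈⟨ +-identityˡ x ⟨
    0# + x <⟨ +-monoˡ-< x 0<1 ⟩
    1# + x ∎

  fromℕ-nonNegative : ∀ n → 0# ≤ fromℕ n
  fromℕ-nonNegative zero    = ≤-refl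
  fromℕ-nonNegative (suc n) = +-nonNegative 0≤1 (fromℕ-nonNegative n)

  fromℕ-positive : ∀ {n} → 0 ℕ.< n → 0# < fromℕ n
  fromℕ-positive {suc n} _ = begin-strict
    0#            ≤⟨ fromℕ-nonNegative n ⟩
    fromℕ n       <⟨ x<1+x (fromℕ n) ⟩
    fromℕ (suc n) ∎

  fromℕ-+ : ∀ m n → fromℕ (m ℕ.+ n) ≈ fromℕ m + fromℕ n
  fromℕ-+ = ×-homo-+ 1#

  fromℕ-mono : ∀ {m n} → m ℕ.≤ n → fromℕ m ≤ fromℕ n
  fromℕ-mono {n = n} z≤n = fromℕ-nonNegative n
  fromℕ-mono (s≤s m≤n)   = +-monoʳ-≤ 1# (fromℕ-mono m≤n)

  fromℕ-≤-∸ : ∀ m n → fromℕ m ≤ fromℕ (m ∸ n) + fromℕ n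
  fromℕ-≤-∸ m n = begin
    fromℕ m                 ≤⟨ fromℕ-mono (ℕ.m≤n+m∸n m n) ⟩
    fromℕ (n ℕ.+ (m ∸ n))   ≈⟨ fromℕ-+ n (m ∸ n) ⟩
    fromℕ n + fromℕ (m ∸ n) ≈⟨ +-comm _ _ ⟩
    fromℕ (m ∸ n) + fromℕ n ∎

  multiple-exceeds : ∀ {x} y → 0# < x → ∃[ n ] y < fromℕ n * x
  multiple-exceeds {x} y 0<x with archimedean (y / x)
  -- The Archimedean bound is not strict; one more multiple makes it so.
  ... | n , y/x≤n = suc n , (begin-strict
    y                 ≈⟨ x/y*y≈x (0<x⇒x≉0 0<x) ⟨
    y / x * x         ≤⟨ *-monoʳ-≤ x (<⇒≤ 0<x) y/x≤n ⟩
    fromℕ n * x       ≈⟨ *-comm _ _ ⟩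
    x * fromℕ n       <⟨ *-monoˡ-< x 0<x (x<1+x (fromℕ n)) ⟩
    x * fromℕ (suc n) ≈⟨ *-comm _ _ ⟩
    fromℕ (suc n) * x ∎)

  -- Starting from an Archimedean bound, `n` is lowered until `n x` no longer exceeds `y`; this
  -- stops at 0 at the latest because `y` is non-negative.
  floor : ∀ {x y} → 0# < x → 0# ≤ y → ∃[ n ] fromℕ n * x ≤ y × y < fromℕ (suc n) * x
  floor {x} {y} 0<x 0≤y with multiple-exceeds y 0<x
  ... | n , y<nx = descend n y<nx
    where
    descend : ∀ n → y < fromℕ n * x → ∃[ m ] fromℕ m * x ≤ y × y < fromℕ (suc m) * x
    descend zero y<0x = contradiction (≤-trans (≤-reflexive (zeroˡ x)) 0≤y) (<⇒≱ y<0x)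
    descend (suc n) y<x+nx with fromℕ n * x ≤? y
    ... | yes nx≤y = n , nx≤y , y<x+nx
    ... | no  nx≰y = descend n (≰⇒> nx≰y)

  /-mono-≤ : ∀ {x y u v} → 0# < y → 0# < v → x * v ≤ u * y → x / y ≤ u / v
  /-mono-≤ {x} {y} {u} {v} 0<y 0<v xv≤uy = *-cancelˡ-≤ (y * v) (*-positive 0<y 0<v) (begin
    y * v * (x / y) ≈⟨ solve 3 (λ y v q → y :* v :* q := q :* y :* v) refl y v (x / y) ⟩
    x / y * y * v   ≈⟨ *-congʳ (x/y*y≈x (0<x⇒x≉0 0<y)) ⟩
    x * v           ≤⟨ xv≤uy ⟩
    u * y           ≈⟨ *-congʳ (x/y*y≈x (0<x⇒x≉0 0<v)) ⟨
    u / v * v * y   ≈⟨ solve 3 (λ y v q → q :* v :* y := y :* v :* q) refl y v (u / v) ⟩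
    y * v * (u / v) ∎)

  x*z<y⇒x<y/z : ∀ {x y z} → 0# < z → x * z < y → x < y / z
  x*z<y⇒x<y/z {x} {y} {z} 0<z xz<y = *-cancelˡ-< z (<⇒≤ 0<z) (begin-strict
    z * x       ≈⟨ *-comm z x ⟩
    x * z       <⟨ xz<y ⟩
    y           ≈⟨ x/y*y≈x (0<x⇒x≉0 0<z) ⟨
    y / z * z   ≈⟨ *-comm _ z ⟩
    z * (y / z) ∎)

  x<y/z⇒x*z<y : ∀ {x y z} → 0# < z → x < y / z → x * z < y
  x<y/z⇒x*z<y {x} {y} {z} 0<z x<y/z = begin-strict
    x * z       ≈⟨ *-comm x z ⟩
    z * x       <⟨ *-monoˡ-< z 0<z x<y/z ⟩
    z * (y / z) ≈⟨ *-comm z _ ⟩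
    y / z * z   ≈⟨ x/y*y≈x (0<x⇒x≉0 0<z) ⟩
    y           ∎

  /-nonNegative : ∀ {x y} → 0# ≤ x → 0# < y → 0# ≤ x / y
  /-nonNegative {x} {y} 0≤x 0<y = *-cancelˡ-≤ y 0<y (begin
    y * 0#      ≈⟨ zeroʳ y ⟩
    0#          ≤⟨ 0≤x ⟩
    x           ≈⟨ x/y*y≈x (0<x⇒x≉0 0<y) ⟨
    x / y * y   ≈⟨ *-comm _ y ⟩
    y * (x / y) ∎)

  +-monoʳ-< : ∀ {x y} z → x < y → z + x < z + y
  +-monoʳ-< {x} {y} z x<y = begin-strict
    z + x ≈⟨ +-comm z x ⟩
    x + z <⟨ +-monoˡ-< z x<y ⟩
    y + z ≈⟨ +-comm y z ⟩
    z + y ∎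

  +-cancelʳ-< : ∀ {x y} z → x + z < y + z → x < y
  +-cancelʳ-< z x+z<y+z = ≰⇒> (<⇒≱ x+z<y+z ∘ +-monoˡ-≤ z)

  x<y⇒0<y-x : ∀ {x y} → x < y → 0# < y - x
  x<y⇒0<y-x {x} {y} x<y = begin-strict
    0#    ≈⟨ -‿inverseʳ x ⟨
    x - x <⟨ +-monoˡ-< (- x) x<y ⟩
    y - x ∎

  fromℕ*x>y≥0⇒n>0 : ∀ n {x y} → 0# ≤ y → y < fromℕ n * x → 0 ℕ.< n
  fromℕ*x>y≥0⇒n>0 zero {x} 0≤y y<0x =
    contradiction (≤-trans (≤-reflexive (zeroˡ x)) 0≤y) (<⇒≱ y<0x)
  fromℕ*x>y≥0⇒n>0 (suc n) 0≤y y<nx = s≤s z≤n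

  -- Finite sums, and minimisation over finitely many candidates.

  sum-mono-≤ : ∀ {T} {f g : Vector Carrier T} → (∀ t → f t ≤ g t) → sum f ≤ sum g
  sum-mono-≤ {zero}  f≤g = ≤-refl
  sum-mono-≤ {suc T} f≤g = +-mono-≤ (f≤g zero) (sum-mono-≤ (f≤g ∘ suc))

  -- `w` is a potential: a step may exceed its share of `g` by the drop in `w`. This serves for
  -- linear programming duality, for counting bursts and for one-off start-up costs.
  sum-telescope : ∀ {T} {f g : Vector Carrier T} (w : Vector Carrier (suc T)) →
                  (∀ t → f t + w (suc t) ≤ g t + w (inject₁ t)) →
                  sum f + w (Fin.fromℕ T) ≤ sum g + w zero
  sum-telescope {zero}          w step = ≤-refl
  sum-telescope {suc T} {f} {g} w step = begin
    f zero + sum (f ∘ suc) + w (Fin.fromℕ (suc T))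
      ≈⟨ +-assoc _ _ _ ⟩
    f zero + (sum (f ∘ suc) + w (Fin.fromℕ (suc T)))
      ≤⟨ +-monoʳ-≤ (f zero) (sum-telescope (w ∘ suc) (step ∘ suc)) ⟩
    f zero + (sum (g ∘ suc) + w (suc zero))
      ≈⟨ solve 3 (λ f g w → f :+ (g :+ w) := f :+ w :+ g) refl _ _ _ ⟩
    f zero + w (suc zero) + sum (g ∘ suc)
      ≤⟨ +-monoˡ-≤ _ (step zero) ⟩
    g zero + w zero + sum (g ∘ suc)
      ≈⟨ solve 3 (λ g w g′ → g :+ w :+ g′ := g :+ g′ :+ w) refl _ _ _ ⟩
    g zero + sum (g ∘ suc) + w zero ∎

  sum-const : ∀ T x → sum {T} (λ _ → x) ≈ fromℕ T * x
  sum-const zero    x = sym (zeroˡ x)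
  sum-const (suc T) x = trans (+-congˡ (sum-const T x))
    (solve 2 (λ x n → x :+ n :* x := (con 1 :+ n) :* x) refl x (fromℕ T))

  -- The feasible set may be infinite, as long as every feasible point is dominated by a feasible
  -- one among finitely many candidates.
  finite-minimiser : ∀ {ℓ ℓ′ k} {A : Set ℓ} {Feasible : A → Set ℓ′} →
    (∀ x → Dec (Feasible x)) → (cost : A → Carrier) (candidate : Fin k → A) →
    (∀ x → Feasible x → ∃[ i ] Feasible (candidate i) × cost (candidate i) ≤ cost x) →
    ∃[ x ] Feasible x → ∃[ x ] IsMinimiser Feasible cost x
  finite-minimiser {k = k} {Feasible = Feasible} feasible? cost candidate dominated
    (x₀ , x₀-feasible)
    with dominated x₀ x₀-feasible
  ... | i₀ , i₀-feasible , _ = candidate best , record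
    { feasible = argmin-all (cost ∘ candidate) i₀-feasible (all-filter candidate? (allFin k))
    ; minimal  = λ x x-feasible → case dominated x x-feasible of λ where
        (i , i-feasible , i≤x) → ≤-trans (best-≤ i i-feasible) i≤x
    }
    where
    open Extrema totalOrder using (argmin; argmin-all; f[argmin]≤f[xs])
    candidate? : ∀ i → Dec (Feasible (candidate i))
    candidate? = feasible? ∘ candidate
    best : Fin k
    -- The default entry of `argmin` competes with the list, so it has to be feasible itself; `i₀`
    -- is the candidate that dominates `x₀`.
    best = argmin (cost ∘ candidate) i₀ (filter candidate? (allFin k))
    best-≤ : ∀ i → Feasible (candidate i) → cost (candidate best) ≤ cost (candidate i)
    best-≤ i i-feasible = All.lookup (f[argmin]≤f[xs] i₀ (filter candidate? (allFin k)))
                            (∈-filter⁺ candidate? (∈-allFin i) i-feasible)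

-- Enumeration and capping of integer sequences.

box : ∀ M T → Fin (suc M ℕ.^ T) → Vector ℕ T
box M T i = toℕ ∘ Fin.finToFun i

-- The sequence is recovered only pointwise, hence the congruence lemmas for `previous`, `increase`
-- and the costs.
box-complete : ∀ {M T} (x : Vector ℕ T) → (∀ t → x t ℕ.≤ M) → ∃[ i ] box M T i ≗ x
box-complete {M} {T} x x≤M = Fin.funToFin f , λ t →
  ≡.trans (≡.cong toℕ (finToFun-funToFin f t)) (toℕ-fromℕ< (s≤s (x≤M t)))
  where
  f : Fin T → Fin (suc M)
  f t = Fin.fromℕ< (s≤s (x≤M t))

previous-cong : ∀ {T} {x x′ : Vector ℕ T} → x ≗ x′ → previous x ≗ previous x′
previous-cong x≗x′ zero    = ≡.refl
previous-cong x≗x′ (suc t) = x≗x′ (inject₁ t)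

-- Prepending the initial 0 turns a schedule into a sequence of states at times 0 to `T`, the index
-- shape of the potentials in `sum-telescope`.
previous-∷ : ∀ {T} (x : Vector ℕ T) t → previous x t ≡ (0 ∷ x) (inject₁ t)
previous-∷ x zero    = ≡.refl
previous-∷ x (suc t) = ≡.refl

previous-map : ∀ {T} (f : ℕ → ℕ) → f 0 ≡ 0 → (x : Vector ℕ T) →
               previous (f ∘ x) ≗ f ∘ previous x
previous-map f f0≡0 x zero    = ≡.sym f0≡0
previous-map f f0≡0 x (suc t) = ≡.refl

-- If `n` is below the cap, it is unchanged while `m` can only shrink; otherwise the difference
-- vanishes. Capping a schedule therefore never adds start-ups.
⊓-∸-≤ : ∀ m n k → (m ⊓ k) ∸ (n ⊓ k) ℕ.≤ m ∸ n
⊓-∸-≤ m n k with ℕ.≤-total n k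
... | inj₁ n≤k rewrite ℕ.m≤n⇒m⊓n≡m n≤k = ℕ.∸-monoˡ-≤ n (ℕ.m⊓n≤m m k)
... | inj₂ k≤n rewrite ℕ.m≥n⇒m⊓n≡n k≤n | ℕ.m≤n⇒m∸n≡0 (ℕ.m⊓n≤n m k) = z≤n

-- Cost estimates and the upper bound on the ratio.

module CostProperties {c ℓ₁ ℓ₂} {F : ArchimedeanOrderedField c ℓ₁ ℓ₂} (P : Parameters F) where

  open ArchimedeanOrderedField F hiding (zero)
  open OrderedFieldProperties F
  open Parameters P
  open ≤-Reasoning

  -- `K` is the slot cost of one generator at full capacity, start-up aside; `R` is the price of the
  -- same energy on the grid at `Pmax`.
  K R : Carrier
  K = L * cₒ + cₘ
  R = L * Pmax

  0≤L : 0# ≤ L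
  0≤L = <⇒≤ 0<L

  L*[cₘ/L]≈cₘ : L * (cₘ / L) ≈ cₘ
  L*[cₘ/L]≈cₘ = trans (*-comm L (cₘ / L)) (x/y*y≈x (0<x⇒x≉0 0<L))

  K<R : K < R
  K<R = begin-strict
    L * cₒ + cₘ            ≈⟨ +-congˡ L*[cₘ/L]≈cₘ ⟨
    L * cₒ + L * (cₘ / L)  ≈⟨ distribˡ L cₒ (cₘ / L) ⟨
    L * (cₒ + cₘ / L)      <⟨ *-monoˡ-< L 0<L cₒ+cₘ/L<Pmax ⟩
    R                      ∎

  cₒ<Pmax : cₒ < Pmax
  cₒ<Pmax = *-cancelˡ-< L 0≤L (begin-strict
    L * cₒ      ≤⟨ x≤x+y 0≤cₘ ⟩
    L * cₒ + cₘ <⟨ K<R ⟩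
    L * Pmax    ∎)

  0≤K : 0# ≤ K
  0≤K = <⇒≤ 0<Lcₒ+cₘ

  0<Pmax : 0# < Pmax
  0<Pmax = begin-strict
    0#   ≤⟨ 0≤cₒ ⟩
    cₒ   <⟨ cₒ<Pmax ⟩
    Pmax ∎

  0<R : 0# < R
  0<R = *-positive 0<L 0<Pmax

  0≤R : 0# ≤ R
  0≤R = <⇒≤ 0<R

  0≤Ly : ∀ y → 0# ≤ L * fromℕ y
  0≤Ly y = *-nonNegative 0≤L (fromℕ-nonNegative y)

  0≤cₘy : ∀ y → 0# ≤ cₘ * fromℕ y
  0≤cₘy y = *-nonNegative 0≤cₘ (fromℕ-nonNegative y)

  0≤cₒLy : ∀ y → 0# ≤ cₒ * L * fromℕ y
  0≤cₒLy y = *-nonNegative (*-nonNegative 0≤cₒ 0≤L) (fromℕ-nonNegative y)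

  ψ-nonNegative : ∀ y {p d} → 0# ≤ p → 0# ≤ d → 0# ≤ ψ P y p d
  ψ-nonNegative y {p} {d} 0≤p 0≤d with p ≤? cₒ
  ... | yes p≤cₒ = +-nonNegative (0≤cₘy y) (*-nonNegative 0≤p 0≤d)
  ... | no  p≰cₒ with d ≤? L * fromℕ y
  ...   | yes d≤Ly = +-nonNegative (0≤cₘy y) (*-nonNegative 0≤cₒ 0≤d)
  ...   | no  d≰Ly = +-nonNegative (+-nonNegative (0≤cₘy y) (0≤cₒLy y))
                       (*-nonNegative 0≤p (x≤y⇒0≤y-x (<⇒≤ (≰⇒> d≰Ly))))

  ψ-mono : ∀ y {p d d′} → 0# ≤ p → d ≤ d′ → ψ P y p d ≤ ψ P y p d′
  ψ-mono y {p} {d} {d′} 0≤p d≤d′ with p ≤? cₒ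
  ... | yes p≤cₒ = +-monoʳ-≤ _ (*-monoˡ-≤ p 0≤p d≤d′)
  ... | no  p≰cₒ with d ≤? L * fromℕ y | d′ ≤? L * fromℕ y
  ...   | yes d≤Ly | yes d′≤Ly = +-monoʳ-≤ _ (*-monoˡ-≤ cₒ 0≤cₒ d≤d′)
  ...   | no  d≰Ly | yes d′≤Ly = contradiction (≤-trans d≤d′ d′≤Ly) d≰Ly
  ...   | no  d≰Ly | no  d′≰Ly = +-monoʳ-≤ _ (*-monoˡ-≤ p 0≤p (+-monoˡ-≤ _ d≤d′))
  -- The capacity lies between the two demands. Both branches of `ψ` take the same value there,
  -- which serves as the intermediate bound.
  ...   | yes d≤Ly | no  d′≰Ly = begin
    cₘ * fromℕ y + cₒ * d
      ≤⟨ +-monoʳ-≤ _ (*-monoˡ-≤ cₒ 0≤cₒ d≤Ly) ⟩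
    cₘ * fromℕ y + cₒ * (L * fromℕ y)
      ≈⟨ +-congˡ (*-assoc cₒ L (fromℕ y)) ⟨
    cₘ * fromℕ y + cₒ * L * fromℕ y
      ≤⟨ x≤x+y (*-nonNegative 0≤p (x≤y⇒0≤y-x (<⇒≤ (≰⇒> d′≰Ly)))) ⟩
    cₘ * fromℕ y + cₒ * L * fromℕ y + p * (d′ - L * fromℕ y) ∎

  ψ-0-≤ : ∀ {p d} → 0# ≤ d → ψ P 0 p d ≤ p * d
  ψ-0-≤ {p} {d} 0≤d with p ≤? cₒ
  ... | yes p≤cₒ = ≤-reflexive (solve 2 (λ c e → c :* con 0 :+ e := e) refl cₘ (p * d))
  ... | no  p≰cₒ with d ≤? L * 0#
  ...   | yes d≤0 = begin
    cₘ * 0# + cₒ * d ≈⟨ solve 2 (λ c e → c :* con 0 :+ e := e) refl cₘ (cₒ * d) ⟩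
    cₒ * d           ≤⟨ *-monoʳ-≤ d 0≤d (<⇒≤ (≰⇒> p≰cₒ)) ⟩
    p * d            ∎
  ...   | no  d≰0 = begin
    cₘ * 0# + cₒ * L * 0# + p * (d - L * 0#)
      ≈⟨ solve 4 (λ c c′ L e → c :* con 0 :+ c′ :* L :* con 0 :+ e := L :* con 0 :+ e)
           refl cₘ cₒ L _ ⟩
    L * 0# + p * (d - L * 0#)
      ≈⟨ solve 3 (λ L p e → L :* con 0 :+ p :* e := p :* (L :* con 0 :+ e)) refl L p _ ⟩
    p * (L * 0# + (d - L * 0#))
      ≈⟨ *-congˡ (x+[y-x]≈y (L * 0#) d) ⟩
    p * d ∎

  -- If the grid is cheap, `ψ` already contains `p d`, and `K < R`. Within capacity, at least
  -- `d / L` generators are active, so a unit of energy costs at least `cₒ + cₘ / L`, which is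
  -- `K / L`, against at most `R / L` on the grid. Beyond capacity, the part `L y` costs exactly
  -- `K / L` per unit and the rest `e` is bought at `p` on both sides.
  K*pd≤R*ψ : ∀ y {p d} → 0# ≤ p → p ≤ Pmax → 0# ≤ d → K * (p * d) ≤ R * ψ P y p d
  K*pd≤R*ψ y {p} {d} 0≤p p≤Pmax 0≤d with p ≤? cₒ
  ... | yes p≤cₒ = begin
    K * (p * d)                  ≤⟨ *-monoʳ-≤ _ (*-nonNegative 0≤p 0≤d) (<⇒≤ K<R) ⟩
    R * (p * d)                  ≤⟨ *-monoˡ-≤ R 0≤R (x≤y+x (0≤cₘy y)) ⟩
    R * (cₘ * fromℕ y + p * d)   ∎
  ... | no  p≰cₒ with d ≤? L * fromℕ y
  ...   | yes d≤Ly = begin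
    K * (p * d)
      ≤⟨ *-monoˡ-≤ K 0≤K (*-monoʳ-≤ d 0≤d p≤Pmax) ⟩
    (L * cₒ + cₘ) * (Pmax * d)
      ≈⟨ solve 5 (λ L o m p d → (L :* o :+ m) :* (p :* d) := L :* p :* (o :* d) :+ p :* m :* d)
           refl L cₒ cₘ Pmax d ⟩
    L * Pmax * (cₒ * d) + Pmax * cₘ * d
      ≤⟨ +-monoʳ-≤ _ (*-monoˡ-≤ _ (*-nonNegative (<⇒≤ 0<Pmax) 0≤cₘ) d≤Ly) ⟩
    L * Pmax * (cₒ * d) + Pmax * cₘ * (L * fromℕ y)
      ≈⟨ solve 5 (λ L e m p y → L :* p :* e :+ p :* m :* (L :* y) := L :* p :* (m :* y :+ e))
           refl L (cₒ * d) cₘ Pmax (fromℕ y) ⟩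
    L * Pmax * (cₘ * fromℕ y + cₒ * d) ∎
  ...   | no  d≰Ly = begin
    K * (p * d)
      ≈⟨ *-congˡ (*-congˡ (x+[y-x]≈y (L * fromℕ y) d)) ⟨
    K * (p * (L * fromℕ y + e))
      ≈⟨ solve 4 (λ K p l e → K :* (p :* (l :+ e)) := K :* (p :* l) :+ K :* (p :* e))
           refl K p (L * fromℕ y) e ⟩
    K * (p * (L * fromℕ y)) + K * (p * e)
      ≤⟨ +-mono-≤ (*-monoˡ-≤ K 0≤K (*-monoʳ-≤ _ (0≤Ly y) p≤Pmax))
                  (*-monoʳ-≤ _ (*-nonNegative 0≤p (x≤y⇒0≤y-x (<⇒≤ (≰⇒> d≰Ly)))) (<⇒≤ K<R)) ⟩
    (L * cₒ + cₘ) * (Pmax * (L * fromℕ y)) + L * Pmax * (p * e)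
      ≈⟨ solve 6 (λ L o m p y pe → (L :* o :+ m) :* (p :* (L :* y)) :+ L :* p :* pe
                                     := L :* p :* (m :* y :+ o :* L :* y :+ pe))
           refl L cₒ cₘ Pmax (fromℕ y) (p * e) ⟩
    L * Pmax * (cₘ * fromℕ y + cₒ * L * fromℕ y + p * e) ∎
    where
    e = d - L * fromℕ y

  -- Cost bounds for a fixed input.

  module _ (I : Input P) where

    open Input I

    0≤p : ∀ t → 0# ≤ p t
    0≤p t = ≤-trans 0≤Pmin (Pmin≤p t)

    0≤d : ∀ t x → 0# ≤ d P I t x
    0≤d t x = g-nonNeg t (fromℕ-nonNegative x) (0≤a t)

    d-mono : ∀ t {x x′} → x ℕ.≤ x′ → d P I t x ≤ d P I t x′
    d-mono t {x} x≤x′ = g-mono t (fromℕ-nonNegative x) (0≤a t) (fromℕ-mono x≤x′) ≤-refl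

    0≤increase : ∀ x t → 0# ≤ increase P I x t
    0≤increase x t = fromℕ-nonNegative (x t ∸ previous x t)

    increase-cong : ∀ {x x′} → x ≗ x′ → increase P I x ≗ increase P I x′
    increase-cong x≗x′ t =
      ≡.cong fromℕ (≡.cong₂ _∸_ (x≗x′ t) (previous-cong x≗x′ t))

    DCM-cost-cong : ∀ {x x′ y y′} → x ≗ x′ → y ≗ y′ →
                    DCM-cost P I (x , y) ≡ DCM-cost P I (x′ , y′)
    DCM-cost-cong x≗x′ y≗y′ = sum-cong-≗ λ t →
      ≡.cong₂ _+_
        (≡.cong₂ _+_ (≡.cong₂ (λ u v → ψ P v (p t) (d P I t u)) (x≗x′ t) (y≗y′ t))
                     (≡.cong (βs *_) (increase-cong x≗x′ t)))
        (≡.cong (βg *_) (increase-cong y≗y′ t))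

    EP-cost-cong : ∀ {y y′} x̄ → y ≗ y′ → EP-cost P I x̄ y ≡ EP-cost P I x̄ y′
    EP-cost-cong x̄ y≗y′ = sum-cong-≗ λ t →
      ≡.cong₂ _+_ (≡.cong (λ v → ψ P v (p t) (d P I t (x̄ t))) (y≗y′ t))
                  (≡.cong (βg *_) (increase-cong y≗y′ t))

    DCM-cost≈EP-cost : ∀ x y → DCM-cost P I (x , y) ≈
                               EP-cost P I x y + sum (λ t → βs * increase P I x t)
    DCM-cost≈EP-cost x y = trans
      (sum-cong-≋ λ t → solve 3 (λ e s g → e :+ s :+ g := e :+ g :+ s) refl
        (ψ P (y t) (p t) (d P I t (x t))) (βs * increase P I x t) (βg * increase P I y t))
      (∑-distrib-+ (λ t → ψ P (y t) (p t) (d P I t (x t)) + βg * increase P I y t)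
                   (λ t → βs * increase P I x t))

    idle : Vector ℕ T
    idle _ = 0

    increase-idle : ∀ t → increase P I idle t ≡ 0#
    increase-idle t = ≡.cong fromℕ (ℕ.0∸n≡0 (previous idle t))

    DCM-cost-idle : ∀ x → DCM-cost P I (x , idle) ≤ CP-cost P I x
    DCM-cost-idle x = sum-mono-≤ λ t → begin
      ψ P 0 (p t) (d P I t (x t)) + βs * increase P I x t + βg * increase P I idle t
        ≡⟨ ≡.cong (λ u → ψ P 0 (p t) (d P I t (x t)) + βs * increase P I x t + βg * u)
             (increase-idle t) ⟩
      ψ P 0 (p t) (d P I t (x t)) + βs * increase P I x t + βg * 0#
        ≈⟨ solve 2 (λ e g → e :+ g :* con 0 := e) refl _ βg ⟩
      ψ P 0 (p t) (d P I t (x t)) + βs * increase P I x t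
        ≤⟨ +-monoˡ-≤ _ (ψ-0-≤ (0≤d t (x t))) ⟩
      p t * d P I t (x t) + βs * increase P I x t ∎

    -- Leaving all generators off is feasible for EP, so `ȳ` does no worse; the server switching
    -- cost is the same on both sides.
    sequential-≤ : ∀ {x̄ ȳ} → IsMinimiser (EP-Feasible P I) (EP-cost P I x̄) ȳ →
                   DCM-cost P I (x̄ , ȳ) ≤ CP-cost P I x̄
    sequential-≤ {x̄} {ȳ} ȳ-optimal = begin
      DCM-cost P I (x̄ , ȳ)
        ≈⟨ DCM-cost≈EP-cost x̄ ȳ ⟩
      EP-cost P I x̄ ȳ + sum (λ t → βs * increase P I x̄ t)
        ≤⟨ +-monoˡ-≤ _ (IsMinimiser.minimal ȳ-optimal idle (λ _ → z≤n)) ⟩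
      EP-cost P I x̄ idle + sum (λ t → βs * increase P I x̄ t)
        ≈⟨ DCM-cost≈EP-cost x̄ idle ⟨
      DCM-cost P I (x̄ , idle)
        ≤⟨ DCM-cost-idle x̄ ⟩
      CP-cost P I x̄ ∎

    K*CP-cost≤R*DCM-cost : ∀ x y → K * CP-cost P I x ≤ R * DCM-cost P I (x , y)
    K*CP-cost≤R*DCM-cost x y = begin
      K * CP-cost P I x         ≈⟨ *-distribˡ-sum K grid ⟩
      sum (λ t → K * grid t)    ≤⟨ sum-mono-≤ slot ⟩
      sum (λ t → R * hybrid t)  ≈⟨ *-distribˡ-sum R hybrid ⟨
      R * DCM-cost P I (x , y)  ∎
      where
      grid hybrid : Vector Carrier T
      grid t   = p t * d P I t (x t) + βs * increase P I x t
      hybrid t = ψ P (y t) (p t) (d P I t (x t)) + βs * increase P I x t + βg * increase P I y t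

      slot : ∀ t → K * grid t ≤ R * hybrid t
      slot t = begin
        K * (p t * d P I t (x t) + s)
          ≈⟨ distribˡ K _ s ⟩
        K * (p t * d P I t (x t)) + K * s
          ≤⟨ +-mono-≤ (K*pd≤R*ψ (y t) (0≤p t) (p≤Pmax t) (0≤d t (x t)))
                      (*-monoʳ-≤ s (*-nonNegative (<⇒≤ 0<βs) (0≤increase x t)) (<⇒≤ K<R)) ⟩
        R * ψ P (y t) (p t) (d P I t (x t)) + R * s
          ≈⟨ distribˡ R _ s ⟨
        R * (ψ P (y t) (p t) (d P I t (x t)) + s)
          ≤⟨ *-monoˡ-≤ R 0≤R (x≤x+y (*-nonNegative (<⇒≤ 0<βg) (0≤increase y t))) ⟩
        R * (ψ P (y t) (p t) (d P I t (x t)) + s + βg * increase P I y t) ∎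
        where
        s = βs * increase P I x t

    -- Only server start-ups are kept, the other costs being non-negative. For the bursty input this
    -- bounds the sequential cost from below, whichever `ȳ` is chosen.
    switching-≤-DCM-cost : ∀ x y → βs * sum (increase P I x) ≤ DCM-cost P I (x , y)
    switching-≤-DCM-cost x y = begin
      βs * sum (increase P I x)         ≈⟨ *-distribˡ-sum βs (increase P I x) ⟩
      sum (λ t → βs * increase P I x t) ≤⟨ sum-mono-≤ (λ t →
        ≤-trans (x≤y+x (ψ-nonNegative (y t) (0≤p t) (0≤d t (x t))))
                (x≤x+y (*-nonNegative (<⇒≤ 0<βg) (0≤increase y t)))) ⟩
      DCM-cost P I (x , y)              ∎

    -- Existence of optimal solutions, and a certificate of optimality for CP.

    truncate : ℕ → Vector ℕ T → Vector ℕ T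
    truncate M x t = x t ⊓ M

    increase-truncate : ∀ M x t → increase P I (truncate M x) t ≤ increase P I x t
    increase-truncate M x t
      rewrite previous-map (_⊓ M) ≡.refl x t = fromℕ-mono (⊓-∸-≤ (x t) (previous x t) M)

    -- Capping lowers the demand and adds no start-ups. With `M` above every workload it also
    -- preserves feasibility, which confines the unbounded choice of `x` to a finite box.
    DCM-cost-truncate : ∀ M x y → DCM-cost P I (truncate M x , y) ≤ DCM-cost P I (x , y)
    DCM-cost-truncate M x y = sum-mono-≤ λ t → +-monoˡ-≤ _ (+-mono-≤
      (ψ-mono (y t) (0≤p t) (d-mono t (ℕ.m⊓n≤m (x t) M)))
      (*-monoˡ-≤ βs (<⇒≤ 0<βs) (increase-truncate M x t)))

    EP-solvable : ∀ x̄ → ∃[ ȳ ] IsMinimiser (EP-Feasible P I) (EP-cost P I x̄) ȳ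
    EP-solvable x̄ = finite-minimiser (λ y → all? (λ t → y t ℕ.≤? N)) (EP-cost P I x̄) (box N T)
      dominated (idle , λ _ → z≤n)
      where
      dominated : ∀ y → EP-Feasible P I y → ∃[ i ] EP-Feasible P I (box N T i) ×
                  EP-cost P I x̄ (box N T i) ≤ EP-cost P I x̄ y
      dominated y y≤N with box-complete y y≤N
      ... | i , i≗y = i , (λ t → ℕ.≤-trans (ℕ.≤-reflexive (i≗y t)) (y≤N t)) ,
                      ≤-reflexive (reflexive (EP-cost-cong x̄ i≗y))

    DCM-solvable : ∀ M → (∀ t → a t ≤ fromℕ M) →
                   ∃[ xy ] IsMinimiser (DCM-Feasible P I) (DCM-cost P I) xy
    DCM-solvable M a≤M = finite-minimiser
      (λ (x , y) → all? (λ t → a t ≤? fromℕ (x t)) ×-dec all? (λ t → y t ℕ.≤? N))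
      (DCM-cost P I) candidate dominated (((λ _ → M) , idle) , a≤M , λ _ → z≤n)
      where
      candidate : Fin (suc M ℕ.^ T ℕ.* suc N ℕ.^ T) → Vector ℕ T × Vector ℕ T
      candidate i = let j , k = Fin.remQuot (suc N ℕ.^ T) i in box M T j , box N T k
      a≤truncate : ∀ x → (∀ t → a t ≤ fromℕ (x t)) → ∀ t → a t ≤ fromℕ (truncate M x t)
      a≤truncate x a≤x t with ℕ.⊓-sel (x t) M
      ... | inj₁ eq = ≤-trans (a≤x t) (≤-reflexive (reflexive (≡.cong fromℕ (≡.sym eq))))
      ... | inj₂ eq = ≤-trans (a≤M t) (≤-reflexive (reflexive (≡.cong fromℕ (≡.sym eq))))
      dominated : ∀ xy → DCM-Feasible P I xy → ∃[ i ] DCM-Feasible P I (candidate i) ×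
                  DCM-cost P I (candidate i) ≤ DCM-cost P I xy
      dominated (x , y) (a≤x , y≤N)
        with box-complete (truncate M x) (λ t → ℕ.m⊓n≤n (x t) M) | box-complete y y≤N
      ... | j , j≗x | k , k≗y
        = Fin.combine j k
        -- Decoding `combine j k` gives back the pair only propositionally, so the claim is proved
        -- for `j` and `k` and transported.
        , ≡.subst (λ (j , k) → DCM-Feasible P I (box M T j , box N T k) ×
                     DCM-cost P I (box M T j , box N T k) ≤ DCM-cost P I (x , y))
            (≡.sym (remQuot-combine j k))
            ( ( (λ t → ≤-trans (a≤truncate x a≤x t)
                         (≤-reflexive (reflexive (≡.cong fromℕ (≡.sym (j≗x t))))))
              , (λ t → ℕ.≤-trans (ℕ.≤-reflexive (k≗y t)) (y≤N t)))
            , (begin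
                DCM-cost P I (box M T j , box N T k) ≡⟨ DCM-cost-cong j≗x k≗y ⟩
                DCM-cost P I (truncate M x , y)      ≤⟨ DCM-cost-truncate M x y ⟩
                DCM-cost P I (x , y)                 ∎))

    -- Here μ is a feasible solution of the linear programming dual of CP, and
    -- the last hypothesis is complementary slackness.
    linear-CP-optimal : (κ : Vector Carrier T) → (∀ t x → d P I t x ≈ κ t * fromℕ x) →
      (x̄ : Vector ℕ T) → (∀ t → a t ≈ fromℕ (x̄ t)) →
      (μ : Vector Carrier (suc T)) → (∀ i → 0# ≤ μ i) → (∀ i → μ i ≤ βs) →
      (∀ t → μ (suc t) ≤ μ (inject₁ t) + p t * κ t) →
      (∀ t → βs * increase P I x̄ t + μ (inject₁ t) * fromℕ (previous x̄ t)
               ≤ μ (inject₁ t) * fromℕ (x̄ t)) →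
      IsMinimiser (CP-Feasible P I) (CP-cost P I) x̄
    linear-CP-optimal κ d≈κx x̄ a≈x̄ μ 0≤μ μ≤βs μ-slope slack = record
      { feasible = λ t → ≤-reflexive (a≈x̄ t)
      ; minimal  = λ x a≤x → begin
          CP-cost P I x̄                            ≤⟨ x≤x+y (0≤w x a≤x (Fin.fromℕ T)) ⟩
          CP-cost P I x̄ + w x (Fin.fromℕ T)        ≤⟨ sum-telescope (w x) (step x a≤x) ⟩
          CP-cost P I x + μ zero * (0# - 0#)       ≈⟨ +-congˡ (*-congˡ (-‿inverseʳ 0#)) ⟩
          CP-cost P I x + μ zero * 0#              ≈⟨ +-congˡ (zeroʳ (μ zero)) ⟩
          CP-cost P I x + 0#                       ≈⟨ +-identityʳ _ ⟩
          CP-cost P I x                            ∎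
      }
      where
      excess : Vector ℕ T → Vector Carrier (suc T)
      excess x i = fromℕ ((0 ∷ x) i) - fromℕ ((0 ∷ x̄) i)

      -- The potential is the excess of `x` over `x̄` valued at the dual price. It starts at 0 and
      -- bounds from below how much more `x` than `x̄` has paid so far.
      w : Vector ℕ T → Vector Carrier (suc T)
      w x i = μ i * excess x i

      0≤excess : ∀ x → CP-Feasible P I x → ∀ i → 0# ≤ excess x i
      0≤excess x a≤x zero    = ≤-reflexive (sym (-‿inverseʳ 0#))
      0≤excess x a≤x (suc t) = x≤y⇒0≤y-x (≤-trans (≤-reflexive (sym (a≈x̄ t))) (a≤x t))

      0≤w : ∀ x → CP-Feasible P I x → ∀ i → 0# ≤ w x i
      0≤w x a≤x i = *-nonNegative (0≤μ i) (0≤excess x a≤x i)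

      step : ∀ x → CP-Feasible P I x → ∀ t →
             p t * d P I t (x̄ t) + βs * increase P I x̄ t + w x (suc t) ≤
             p t * d P I t (x t) + βs * increase P I x t + w x (inject₁ t)
      step x a≤x t = begin
        p t * d P I t (x̄ t) + βs * ī + μ₁ * e
          -- Adding `μ₀ * ȳ` to both sides makes the left-hand side of `slack` appear. Here `ȳ` is
          -- the preceding server level of `x̄`, not a generator schedule.
          ≤⟨ +-cancelʳ-≤ (μ₀ * ȳ) (begin
            p t * d P I t (x̄ t) + βs * ī + μ₁ * e + μ₀ * ȳ
              ≈⟨ +-congʳ (+-congʳ (+-congʳ (*-congˡ (d≈κx t (x̄ t))))) ⟩
            p t * (κ t * X̄) + βs * ī + μ₁ * e + μ₀ * ȳ
              ≤⟨ +-monoˡ-≤ _ (+-monoʳ-≤ _ (*-monoʳ-≤ e (0≤excess x a≤x (suc t)) (μ-slope t))) ⟩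
            p t * (κ t * X̄) + βs * ī + (μ₀ + p t * κ t) * e + μ₀ * ȳ
              ≈⟨ solve 7 (λ p k X b m e y → p :* (k :* X) :+ b :+ (m :+ p :* k) :* e :+ m :* y
                                              := p :* (k :* (X :+ e)) :+ m :* e :+ (b :+ m :* y))
                   refl (p t) (κ t) X̄ (βs * ī) μ₀ e ȳ ⟩
            p t * (κ t * (X̄ + e)) + μ₀ * e + (βs * ī + μ₀ * ȳ)
              ≤⟨ +-monoʳ-≤ _ (slack t) ⟩
            p t * (κ t * (X̄ + e)) + μ₀ * e + μ₀ * X̄
              ≈⟨ solve 5 (λ p k X m e → p :* (k :* (X :+ e)) :+ m :* e :+ m :* X
                                          := p :* (k :* (X :+ e)) :+ m :* (X :+ e))
                   refl (p t) (κ t) X̄ μ₀ e ⟩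
            p t * (κ t * (X̄ + e)) + μ₀ * (X̄ + e)
              ≈⟨ +-cong (*-congˡ (*-congˡ (x+[y-x]≈y X̄ X))) (*-congˡ (x+[y-x]≈y X̄ X)) ⟩
            p t * (κ t * X) + μ₀ * X
              ≈⟨ +-congʳ (*-congˡ (d≈κx t (x t))) ⟨
            p t * d P I t (x t) + μ₀ * X
              ≤⟨ +-monoʳ-≤ _ (*-monoˡ-≤ μ₀ (0≤μ _) (fromℕ-≤-∸ (x t) (previous x t))) ⟩
            p t * d P I t (x t) + μ₀ * (i + fromℕ (previous x t))
              ≈⟨ +-congˡ (*-congˡ (+-congˡ (x+[y-x]≈y ȳ (fromℕ (previous x t))))) ⟨
            p t * d P I t (x t) + μ₀ * (i + (ȳ + e₀))
              ≈⟨ solve 5 (λ c m i y e → c :+ m :* (i :+ (y :+ e))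
                         := m :* i :+ (c :+ m :* e :+ m :* y))
                   refl (p t * d P I t (x t)) μ₀ i ȳ e₀ ⟩
            μ₀ * i + (p t * d P I t (x t) + μ₀ * e₀ + μ₀ * ȳ)
              ≤⟨ +-monoˡ-≤ _ (*-monoʳ-≤ i (0≤increase x t) (μ≤βs _)) ⟩
            βs * i + (p t * d P I t (x t) + μ₀ * e₀ + μ₀ * ȳ)
              ≈⟨ solve 4 (λ b c e y → b :+ (c :+ e :+ y) := c :+ b :+ e :+ y)
                   refl (βs * i) (p t * d P I t (x t)) (μ₀ * e₀) (μ₀ * ȳ) ⟩
            p t * d P I t (x t) + βs * i + μ₀ * e₀ + μ₀ * ȳ ∎) ⟩
        p t * d P I t (x t) + βs * i + μ₀ * e₀
          ≡⟨ ≡.cong₂ (λ u v → p t * d P I t (x t) + βs * i + μ₀ * (fromℕ u - fromℕ v))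
               (previous-∷ x t) (previous-∷ x̄ t) ⟩
        p t * d P I t (x t) + βs * i + w x (inject₁ t) ∎
        where
        μ₀ = μ (inject₁ t)
        μ₁ = μ (suc t)
        X  = fromℕ (x t)
        X̄  = fromℕ (x̄ t)
        ȳ  = fromℕ (previous x̄ t)
        e₀ = fromℕ (previous x t) - ȳ
        e  = excess x (suc t)
        i  = increase P I x t
        ī  = increase P I x̄ t

  ratio-≤ : ∀ i → ratio P i ≤ R / K
  ratio-≤ i = /-mono-≤ 0<cost* 0<Lcₒ+cₘ (begin
    DCM-cost P input (x̄ , ȳ) * K   ≈⟨ *-comm _ K ⟩
    K * DCM-cost P input (x̄ , ȳ)   ≤⟨ *-monoˡ-≤ K 0≤K (sequential-≤ input ȳ-optimal) ⟩
    -- `x*` meets the workload constraint, so it competes with `x̄` in CP.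
    K * CP-cost P input x̄          ≤⟨ *-monoˡ-≤ K 0≤K
      (IsMinimiser.minimal x̄-optimal x* (proj₁ (IsMinimiser.feasible x*y*-optimal))) ⟩
    K * CP-cost P input x*         ≤⟨ K*CP-cost≤R*DCM-cost input x* y* ⟩
    R * DCM-cost P input (x* , y*) ∎)
    where open Instance i

-- The periodic burst pattern.

next : ℕ → ℕ → ℕ
next m j with j ℕ.≟ m
... | yes _ = 0
... | no  _ = suc j

burst : ℕ → ℕ → ℕ → ℕ
burst m n j with j ℕ.≟ m
... | yes _ = n
... | no  _ = 0

-- The position in a cycle of `m + 1` slots, whose last slot carries the burst. The recursive form,
-- in place of a remainder, reduces each argument to a single use of `next`.
phase : ℕ → ℕ → ℕ
phase m zero    = 0
phase m (suc i) = next m (phase m i)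

load : ℕ → ℕ → ℕ → ℕ
load m n i = burst m n (phase m i)

next-≤ : ∀ {m j} → j ℕ.≤ m → next m j ℕ.≤ m
next-≤ {m} {j} j≤m with j ℕ.≟ m
... | yes _   = z≤n
... | no  j≢m = ℕ.≤∧≢⇒< j≤m j≢m

next-≤-suc : ∀ m j → next m j ℕ.≤ suc j
next-≤-suc m j with j ℕ.≟ m
... | yes _ = z≤n
... | no  _ = ℕ.≤-refl

burst-≤ : ∀ m n j → burst m n j ℕ.≤ n
burst-≤ m n j with j ℕ.≟ m
... | yes _ = ℕ.≤-refl
... | no  _ = z≤n

burst-before-reset : ∀ m n j → 0 ℕ.< next m j → burst m n j ≡ 0
burst-before-reset m n j 0<next with j ℕ.≟ m
... | no _ = ≡.refl

phase-≤ : ∀ m i → phase m i ℕ.≤ m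
phase-≤ m zero    = z≤n
phase-≤ m (suc i) = next-≤ (phase-≤ m i)

-- At a positive phase the cycle has not just restarted, so the preceding slot was no burst. The
-- first slot is excluded by its phase 0.
previous-load : ∀ m n {T} (t : Fin T) → 0 ℕ.< phase m (toℕ t) →
                previous (load m n ∘ toℕ) t ≡ 0
previous-load m n (suc t) 0<phase
  rewrite toℕ-inject₁ t = burst-before-reset m n (phase m (toℕ t)) 0<phase

-- Summed over time, the potential n (m ∸ j) telescopes and bounds the total
-- increase of the load from below.
burst-increase : ∀ m n {j k} → 0 ℕ.< m → j ℕ.≤ m → (0 ℕ.< j → k ≡ 0) →
  n ℕ.+ n ℕ.* (m ∸ next m j) ℕ.≤ suc m ℕ.* (burst m n j ∸ k) ℕ.+ n ℕ.* (m ∸ j)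
burst-increase m n {j} {k} 0<m j≤m k≡0 with j ℕ.≟ m
-- As `m` is positive, so is the burst phase; hence `k` is 0 and all `n` servers start anew. Counted
-- `m + 1` times, they pay for this slot and for raising the potential from 0 to `n m`.
... | yes ≡.refl rewrite k≡0 0<m = begin
  n ℕ.+ n ℕ.* m                     ≡⟨ ≡.cong (n ℕ.+_) (ℕ.*-comm n m) ⟩
  suc m ℕ.* n                       ≤⟨ ℕ.m≤m+n (suc m ℕ.* n) _ ⟩
  suc m ℕ.* n ℕ.+ n ℕ.* (m ∸ m)     ∎
  where open ℕ.≤-Reasoning
-- Off the burst the potential falls by exactly `n`.
... | no  j≢m = begin
  n ℕ.+ n ℕ.* (m ∸ suc j)           ≡⟨ ℕ.*-suc n (m ∸ suc j) ⟨
  n ℕ.* suc (m ∸ suc j)             ≡⟨ ≡.cong (n ℕ.*_) (ℕ.+-∸-assoc 1 (ℕ.≤∧≢⇒< j≤m j≢m)) ⟨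
  n ℕ.* (m ∸ j)                     ≤⟨ ℕ.m≤n+m (n ℕ.* (m ∸ j)) _ ⟩
  suc m ℕ.* (0 ∸ k) ℕ.+ n ℕ.* (m ∸ j) ∎
  where open ℕ.≤-Reasoning

-- Bursty inputs whose ratio approaches the bound.

module Tightness {c ℓ₁ ℓ₂} {F : ArchimedeanOrderedField c ℓ₁ ℓ₂} (P : Parameters F) where

  open ArchimedeanOrderedField F hiding (zero)
  open Parameters P
  open OrderedFieldProperties F
  open CostProperties P
  open ≤-Reasoning

  module BurstyInput (m n T : ℕ) (0<m : 0 ℕ.< m) (κ : Carrier) (0≤κ : 0# ≤ κ)
    (mPmaxκ≈βs : fromℕ m * (Pmax * κ) ≈ βs) (κn≤L : κ * fromℕ n ≤ L) where

    input : Input P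
    input = record
      { T        = T
      ; a        = λ t → fromℕ (load m n (toℕ t))
      ; p        = λ _ → Pmax
      ; g        = λ _ x _ → κ * x
      ; 0≤a      = λ t → fromℕ-nonNegative (load m n (toℕ t))
      ; Pmin≤p   = λ _ → Pmin≤Pmax
      ; p≤Pmax   = λ _ → ≤-refl
      ; g-nonNeg = λ _ 0≤x _ → *-nonNegative 0≤κ 0≤x
      ; g-mono   = λ _ _ _ x≤x′ _ → *-monoˡ-≤ κ 0≤κ x≤x′
      ; g-convex = λ _ {θ} {x} {x′} _ _ _ _ _ _ → ≤-reflexive
          (solve 5 (λ k θ x θ′ x′ → k :* (θ :* x :+ θ′ :* x′) := θ :* (k :* x) :+ θ′ :* (k :* x′))
            refl κ θ x (1# - θ) x′)
      }

    x̄ : Vector ℕ T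
    x̄ = load m n ∘ toℕ

    -- The dual price is 0 at the start of a cycle, rises by the grid cost of keeping one server on
    -- for a slot, and reaches `βs` exactly at the burst.
    μ : Vector Carrier (suc T)
    μ i = fromℕ (phase m (toℕ i)) * (Pmax * κ)

    0≤Pmaxκ : 0# ≤ Pmax * κ
    0≤Pmaxκ = *-nonNegative (<⇒≤ 0<Pmax) 0≤κ

    x̄-optimal : IsMinimiser (CP-Feasible P input) (CP-cost P input) x̄
    x̄-optimal = linear-CP-optimal input (λ _ → κ) (λ _ _ → refl) x̄ (λ _ → refl) μ
      (λ i → *-nonNegative (fromℕ-nonNegative (phase m (toℕ i))) 0≤Pmaxκ)
      (λ i → ≤-trans (*-monoʳ-≤ (Pmax * κ) 0≤Pmaxκ (fromℕ-mono (phase-≤ m (toℕ i))))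
                     (≤-reflexive mPmaxκ≈βs))
      slope slack
      where
      slope : ∀ t → μ (suc t) ≤ μ (inject₁ t) + Pmax * κ
      slope t rewrite toℕ-inject₁ t = begin
        fromℕ (next m j) * (Pmax * κ)
          ≤⟨ *-monoʳ-≤ _ 0≤Pmaxκ (fromℕ-mono (next-≤-suc m j)) ⟩
        (1# + fromℕ j) * (Pmax * κ)
          ≈⟨ solve 2 (λ j q → (con 1 :+ j) :* q := j :* q :+ q) refl (fromℕ j) (Pmax * κ) ⟩
        fromℕ j * (Pmax * κ) + Pmax * κ ∎
        where
        j = phase m (toℕ t)

      burst-slack : ∀ j k → (0 ℕ.< j → k ≡ 0) →
        βs * fromℕ (burst m n j ∸ k) + fromℕ j * (Pmax * κ) * fromℕ k
          ≤ fromℕ j * (Pmax * κ) * fromℕ (burst m n j)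
      -- At phase 0 the preceding load `k` may be positive, but the dual price is 0 and no server is
      -- requested.
      burst-slack zero k _ with 0 ℕ.≟ m
      ... | yes ≡.refl = contradiction 0<m (ℕ.<-irrefl ≡.refl)
      ... | no  _ rewrite ℕ.0∸n≡0 k = ≤-reflexive
        (solve 3 (λ b q k → b :* con 0 :+ con 0 :* q :* k := con 0 :* q :* con 0)
          refl βs (Pmax * κ) (fromℕ k))
      burst-slack (suc j) k k≡0 rewrite k≡0 (s≤s z≤n) with suc j ℕ.≟ m
      ... | yes ≡.refl = ≤-reflexive (trans (+-congʳ (*-congʳ (sym mPmaxκ≈βs)))
        (solve 3 (λ j q n → j :* q :* n :+ j :* q :* con 0 := j :* q :* n)
          refl (fromℕ m) (Pmax * κ) (fromℕ n)))
      ... | no  _ = ≤-reflexive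
        (solve 2 (λ b q → b :* con 0 :+ q := q) refl βs (fromℕ (suc j) * (Pmax * κ) * 0#))

      slack : ∀ t → βs * increase P input x̄ t + μ (inject₁ t) * fromℕ (previous x̄ t)
                      ≤ μ (inject₁ t) * fromℕ (x̄ t)
      slack t rewrite toℕ-inject₁ t =
        burst-slack (phase m (toℕ t)) (previous x̄ t) (previous-load m n t)

    switching : Carrier
    switching = βs * sum (increase P input x̄)

    -- One slot in `m + 1` starts `n` servers; the last term makes up for an unfinished cycle.
    switching-≥ : fromℕ T * (fromℕ n * βs) ≤
                  fromℕ (suc m) * switching + fromℕ n * βs * fromℕ m
    switching-≥ = begin
      fromℕ T * (fromℕ n * βs)
        ≈⟨ trans (sym (*-assoc _ _ _)) (*-comm _ βs) ⟩
      βs * (fromℕ T * fromℕ n)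
        ≤⟨ *-monoˡ-≤ βs (<⇒≤ 0<βs) (begin
          fromℕ T * fromℕ n
            ≈⟨ sum-const T (fromℕ n) ⟨
          sum {T} (λ _ → fromℕ n)
            ≤⟨ x≤x+y (fromℕ-nonNegative (n ℕ.* (m ∸ phase m (toℕ (Fin.fromℕ T))))) ⟩
          sum {T} (λ _ → fromℕ n) + w (Fin.fromℕ T)
            ≤⟨ sum-telescope w step ⟩
          sum (λ t → fromℕ (suc m) * increase P input x̄ t) + fromℕ (n ℕ.* m)
            ≈⟨ +-cong (sym (*-distribˡ-sum (fromℕ (suc m)) (increase P input x̄))) (×1-homo-* n m) ⟩
          fromℕ (suc m) * sum (increase P input x̄) + fromℕ n * fromℕ m ∎) ⟩
      βs * (fromℕ (suc m) * sum (increase P input x̄) + fromℕ n * fromℕ m)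
        ≈⟨ solve 5 (λ b m′ s n m → b :* (m′ :* s :+ n :* m) := m′ :* (b :* s) :+ n :* b :* m)
             refl βs (fromℕ (suc m)) (sum (increase P input x̄)) (fromℕ n) (fromℕ m) ⟩
      fromℕ (suc m) * switching + fromℕ n * βs * fromℕ m ∎
      where
      w : Vector Carrier (suc T)
      w i = fromℕ (n ℕ.* (m ∸ phase m (toℕ i)))

      step : ∀ t → fromℕ n + w (suc t) ≤ fromℕ (suc m) * increase P input x̄ t + w (inject₁ t)
      step t rewrite toℕ-inject₁ t = begin
        fromℕ n + fromℕ (n ℕ.* (m ∸ next m j))
          ≈⟨ fromℕ-+ n (n ℕ.* (m ∸ next m j)) ⟨
        fromℕ (n ℕ.+ n ℕ.* (m ∸ next m j))
          ≤⟨ fromℕ-mono (burst-increase m n 0<m (phase-≤ m (toℕ t)) (previous-load m n t)) ⟩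
        fromℕ (suc m ℕ.* (burst m n j ∸ previous x̄ t) ℕ.+ n ℕ.* (m ∸ j))
          ≈⟨ fromℕ-+ (suc m ℕ.* (burst m n j ∸ previous x̄ t)) (n ℕ.* (m ∸ j)) ⟩
        fromℕ (suc m ℕ.* (burst m n j ∸ previous x̄ t)) + fromℕ (n ℕ.* (m ∸ j))
          ≈⟨ +-congʳ (×1-homo-* (suc m) (burst m n j ∸ previous x̄ t)) ⟩
        fromℕ (suc m) * increase P input x̄ t + fromℕ (n ℕ.* (m ∸ j)) ∎
        where
        j = phase m (toℕ t)

    steady-cost : Carrier
    steady-cost = fromℕ T * K + (fromℕ n * βs + βg)

    ψ-full-≤ : ψ P 1 Pmax (κ * fromℕ n) ≤ K
    ψ-full-≤ with Pmax ≤? cₒ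
    ... | yes Pmax≤cₒ = contradiction Pmax≤cₒ (<⇒≱ cₒ<Pmax)
    ... | no  _ with κ * fromℕ n ≤? L * fromℕ 1
    ...   | yes _ = begin
      cₘ * fromℕ 1 + cₒ * (κ * fromℕ n) ≤⟨ +-monoʳ-≤ _ (*-monoˡ-≤ cₒ 0≤cₒ κn≤L) ⟩
      cₘ * fromℕ 1 + cₒ * L
        ≈⟨ solve 3 (λ m o l → m :* (con 1 :+ con 0) :+ o :* l := l :* o :+ m)
             refl cₘ cₒ L ⟩
      L * cₒ + cₘ                       ∎
    ...   | no  κn≰L = contradiction (≤-trans κn≤L (≤-reflexive
                         (solve 1 (λ l → l := l :* (con 1 :+ con 0)) refl L))) κn≰L

    steady-≤ : DCM-cost P input ((λ _ → n) , (λ _ → 1)) ≤ steady-cost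
    steady-≤ = begin
      DCM-cost P input (x , y)
        ≤⟨ x≤x+y (+-nonNegative
             (*-nonNegative (<⇒≤ 0<βs) (fromℕ-nonNegative (n ∸ (0 ∷ x) (Fin.fromℕ T))))
             (*-nonNegative (<⇒≤ 0<βg) (fromℕ-nonNegative (1 ∸ (0 ∷ y) (Fin.fromℕ T))))) ⟩
      DCM-cost P input (x , y) + w (Fin.fromℕ T)   ≤⟨ sum-telescope w step ⟩
      sum {T} (λ _ → K) + w zero                   ≈⟨ +-cong (sum-const T K)
        (solve 3 (λ n s g → s :* n :+ g :* (con 1 :+ con 0) := n :* s :+ g) refl (fromℕ n) βs βg) ⟩
      steady-cost ∎
      where
      x y : Vector ℕ T
      x _ = n
      y _ = 1

      -- The potential is the switching cost still to come: all of it at time 0, none later. This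
      -- treats the first slot and an empty horizon uniformly.
      w : Vector Carrier (suc T)
      w i = βs * fromℕ (n ∸ (0 ∷ x) i) + βg * fromℕ (1 ∸ (0 ∷ y) i)

      step : ∀ t → ψ P 1 Pmax (κ * fromℕ n) + βs * increase P input x t + βg * increase P input y t
                     + w (suc t) ≤ K + w (inject₁ t)
      step t rewrite previous-∷ x t | previous-∷ y t | ℕ.n∸n≡0 n = begin
        ψ P 1 Pmax (κ * fromℕ n) + βs * i + βg * j + (βs * 0# + βg * 0#)
          ≤⟨ +-monoˡ-≤ _ (+-monoˡ-≤ _ (+-monoˡ-≤ _ ψ-full-≤)) ⟩
        K + βs * i + βg * j + (βs * 0# + βg * 0#)
          ≈⟨ solve 5 (λ K s g i j → K :+ s :* i :+ g :* j :+ (s :* con 0 :+ g :* con 0)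
                     := K :+ (s :* i :+ g :* j))
               refl K βs βg i j ⟩
        K + (βs * i + βg * j) ∎
        where
        i = fromℕ (n ∸ (0 ∷ x) (inject₁ t))
        j = fromℕ (1 ∸ (0 ∷ y) (inject₁ t))

    module _ {σ} (0≤σ : 0# ≤ σ) (σB<A : σ * steady-cost < switching) where

      private
        0≤steady-cost : 0# ≤ steady-cost
        0≤steady-cost = +-nonNegative (*-nonNegative (fromℕ-nonNegative T) 0≤K)
          (+-nonNegative (*-nonNegative (fromℕ-nonNegative n) (<⇒≤ 0<βs)) (<⇒≤ 0<βg))

        a≤n : ∀ t → fromℕ (x̄ t) ≤ fromℕ n
        a≤n t = fromℕ-mono (burst-≤ m n (phase m (toℕ t)))

      -- The steady schedule, feasible because `0 < N`, bounds the optimum from above, and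
      -- `switching` bounds the sequential cost from below.
      solved-ratio-exceeds : ∀ {ȳ x* y*} →
        IsMinimiser (EP-Feasible P input) (EP-cost P input x̄) ȳ →
        IsMinimiser (DCM-Feasible P input) (DCM-cost P input) (x* , y*) → ∃[ i ] σ < ratio P i
      solved-ratio-exceeds {ȳ} {x*} {y*} ȳ-optimal x*y*-optimal =
        instance′ , x*z<y⇒x<y/z 0<cost* (begin-strict
        σ * DCM-cost P input (x* , y*)
          ≤⟨ *-monoˡ-≤ σ 0≤σ (IsMinimiser.minimal x*y*-optimal ((λ _ → n) , (λ _ → 1))
               (a≤n , (λ _ → 0<N))) ⟩
        σ * DCM-cost P input ((λ _ → n) , (λ _ → 1))
          ≤⟨ *-monoˡ-≤ σ 0≤σ steady-≤ ⟩
        σ * steady-cost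
          <⟨ σB<A ⟩
        switching
          ≤⟨ switching-≤-DCM-cost input x̄ ȳ ⟩
        DCM-cost P input (x̄ , ȳ) ∎)
        where
        0<cost* : 0# < DCM-cost P input (x* , y*)
        -- Positivity passes from `switching` to the CP cost of `x̄`, then to that of `x*`, and from
        -- there to the joint optimum.
        0<cost* = *-cancelˡ-< R 0≤R (begin-strict
          R * 0#                           ≈⟨ zeroʳ R ⟩
          0#                               <⟨ *-positive 0<Lcₒ+cₘ (begin-strict
            0#                        ≤⟨ *-nonNegative 0≤σ 0≤steady-cost ⟩
            σ * steady-cost           <⟨ σB<A ⟩
            switching                 ≤⟨ switching-≤-DCM-cost input x̄ ȳ ⟩
            DCM-cost P input (x̄ , ȳ)  ≤⟨ sequential-≤ input ȳ-optimal ⟩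
            CP-cost P input x̄         ≤⟨ IsMinimiser.minimal x̄-optimal x*
                                         (proj₁ (IsMinimiser.feasible x*y*-optimal)) ⟩
            CP-cost P input x*        ∎) ⟩
          K * CP-cost P input x*           ≤⟨ K*CP-cost≤R*DCM-cost input x* y* ⟩
          R * DCM-cost P input (x* , y*)   ∎)

        instance′ : Instance P
        instance′ = record
          { input        = input
          ; x̄            = x̄
          ; ȳ            = ȳ
          ; x*           = x*
          ; y*           = y*
          ; x̄-optimal    = x̄-optimal
          ; ȳ-optimal    = ȳ-optimal
          ; x*y*-optimal = x*y*-optimal
          ; 0<cost*      = 0<cost*
          }

      ratio-exceeds : ∃[ i ] σ < ratio P i
      ratio-exceeds =
        solved-ratio-exceeds (proj₂ (EP-solvable input x̄)) (proj₂ (DCM-solvable input n a≤n))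

  -- Choice of the cycle length, the number of servers and the horizon.

  0<ρ : 0# < R / K
  0<ρ = x*z<y⇒x<y/z 0<Lcₒ+cₘ (begin-strict
    0# * K ≈⟨ zeroˡ K ⟩
    0#     <⟨ 0<R ⟩
    R      ∎)

  module _ {σ} (0≤σ : 0# ≤ σ) (σ<ρ : σ < R / K) where

    τ : Carrier
    τ = σ * K

    0≤τ : 0# ≤ τ
    0≤τ = *-nonNegative 0≤σ 0≤K

    τ<R : τ < R
    τ<R = x<y/z⇒x*z<y 0<Lcₒ+cₘ σ<ρ

    module _ (m : ℕ) (m-large : βs + τ < fromℕ m * (R - τ))
             (n : ℕ) (nβs≤mR : fromℕ n * βs ≤ fromℕ m * R)
             (mR<[1+n]βs : fromℕ m * R < fromℕ (suc n) * βs) where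

      -- The surplus per cycle: the cost of starting a burst minus `σ` times the cost of one full
      -- generator over `m + 1` slots.
      gain : Carrier
      gain = fromℕ n * βs - fromℕ (suc m) * τ

      -- Rounding `m R / βs` down to `n` loses less than one `βs`, and `m-large` says that `m R`
      -- exceeds `(m + 1) τ` by more than that.
      0<gain : 0# < gain
      0<gain = x<y⇒0<y-x (+-cancelʳ-< βs (begin-strict
        (1# + fromℕ m) * τ + βs
          ≈⟨ solve 3 (λ m t b → (con 1 :+ m) :* t :+ b := b :+ t :+ m :* t)
               refl (fromℕ m) τ βs ⟩
        βs + τ + fromℕ m * τ            <⟨ +-monoˡ-< _ m-large ⟩
        fromℕ m * (R - τ) + fromℕ m * τ
          ≈⟨ solve 3 (λ m t b → m :* b :+ m :* t := m :* (t :+ b))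
               refl (fromℕ m) τ (R - τ) ⟩
        fromℕ m * (τ + (R - τ))         ≈⟨ *-congˡ (x+[y-x]≈y τ R) ⟩
        fromℕ m * R                     <⟨ mR<[1+n]βs ⟩
        (1# + fromℕ n) * βs
          ≈⟨ solve 2 (λ n b → (con 1 :+ n) :* b := n :* b :+ b)
               refl (fromℕ n) βs ⟩
        fromℕ n * βs + βs               ∎))

      0<m : 0 ℕ.< m
      0<m = fromℕ*x>y≥0⇒n>0 m (+-nonNegative (<⇒≤ 0<βs) 0≤τ) m-large

      0<mPmax : 0# < fromℕ m * Pmax
      0<mPmax = *-positive (fromℕ-positive 0<m) 0<Pmax

      κ : Carrier
      κ = βs / (fromℕ m * Pmax)

      0≤κ : 0# ≤ κ
      0≤κ = /-nonNegative (<⇒≤ 0<βs) 0<mPmax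

      mPmaxκ≈βs : fromℕ m * (Pmax * κ) ≈ βs
      mPmaxκ≈βs = trans (sym (*-assoc _ _ _)) (trans (*-comm _ κ) (x/y*y≈x (0<x⇒x≉0 0<mPmax)))

      -- Multiplied by `m Pmax` this is `n βs ≤ m R`, the reason for rounding `n` down.
      κn≤L : κ * fromℕ n ≤ L
      κn≤L = *-cancelˡ-≤ (fromℕ m * Pmax) 0<mPmax (begin
        fromℕ m * Pmax * (κ * fromℕ n)
          ≈⟨ solve 4 (λ m p k n → m :* p :* (k :* n) := n :* (m :* (p :* k)))
               refl (fromℕ m) Pmax κ (fromℕ n) ⟩
        fromℕ n * (fromℕ m * (Pmax * κ)) ≈⟨ *-congˡ mPmaxκ≈βs ⟩
        fromℕ n * βs                     ≤⟨ nβs≤mR ⟩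
        fromℕ m * (L * Pmax)
          ≈⟨ solve 3 (λ m l p → m :* (l :* p) := m :* p :* l)
               refl (fromℕ m) L Pmax ⟩
        fromℕ m * Pmax * L               ∎)

      -- The terms that do not grow with `T`: the initial switching in `steady-cost` and the
      -- unfinished cycle in `switching-≥`.
      overhead : Carrier
      overhead = fromℕ (suc m) * (σ * (fromℕ n * βs + βg)) + fromℕ n * βs * fromℕ m

      module _ (T : ℕ) (T-large : overhead < fromℕ T * gain) where

        open BurstyInput m n T 0<m κ 0≤κ mPmaxκ≈βs κn≤L

        σ*steady-cost<switching : σ * steady-cost < switching
        σ*steady-cost<switching = *-cancelˡ-< (fromℕ (suc m)) (fromℕ-nonNegative (suc m))
          (+-cancelʳ-< (fromℕ n * βs * fromℕ m) (begin-strict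
            m′ * (σ * (fromℕ T * K + B₀)) + S
              ≈⟨ solve 6 (λ m s T K B S → m :* (s :* (T :* K :+ B)) :+ S
                         := T :* (m :* (s :* K)) :+ (m :* (s :* B) :+ S))
                   refl m′ σ (fromℕ T) K B₀ S ⟩
            fromℕ T * (m′ * τ) + overhead
              <⟨ +-monoʳ-< _ T-large ⟩
            fromℕ T * (m′ * τ) + fromℕ T * gain
              ≈⟨ distribˡ (fromℕ T) (m′ * τ) gain ⟨
            fromℕ T * (m′ * τ + gain)
              ≈⟨ *-congˡ (x+[y-x]≈y (m′ * τ) (fromℕ n * βs)) ⟩
            fromℕ T * (fromℕ n * βs)
              ≤⟨ switching-≥ ⟩
            m′ * switching + S ∎))
          where
          m′ = fromℕ (suc m)
          B₀ = fromℕ n * βs + βg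
          S  = fromℕ n * βs * fromℕ m

        long-burst-exceeds : ∃[ i ] σ < ratio P i
        long-burst-exceeds = ratio-exceeds 0≤σ σ*steady-cost<switching

      burst-exceeds : ∃[ i ] σ < ratio P i
      burst-exceeds = uncurry long-burst-exceeds (multiple-exceeds overhead 0<gain)

    exceeds : ∃[ i ] σ < ratio P i
    exceeds = uncurry
      -- First `m` is taken large, then `n` as the integer part of `m R / βs`; `T` depends on both
      -- and is chosen in `burst-exceeds`.
      (λ m m-large → uncurry (λ n → uncurry (burst-exceeds m m-large n))
        (floor 0<βs (*-nonNegative (fromℕ-nonNegative m) 0≤R)))
      (multiple-exceeds (βs + τ) (x<y⇒0<y-x τ<R))

  tight : Tight P (R / K)
  tight ε 0<ε with 0# ≤? R / K - ε
  ... | yes 0≤σ = exceeds 0≤σ (begin-strict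
    R / K - ε       ≈⟨ +-identityˡ _ ⟨
    0# + (R / K - ε) <⟨ +-monoˡ-< _ 0<ε ⟩
    ε + (R / K - ε) ≈⟨ x+[y-x]≈y ε (R / K) ⟩
    R / K           ∎)
  -- A negative target is beaten by any instance that beats `σ` = 0.
  ... | no  0≰σ = map₂ (<-trans (≰⇒> 0≰σ)) (exceeds ≤-refl 0<ρ)

  supremum : IsSupremum (ratio P) (R / K)
  supremum = record
    { upperBound = ratio-≤
    ; least      = λ u ratio≤u → case R / K ≤? u of λ where
        (yes ρ≤u) → ρ≤u
        -- With `ε` equal to `R / K - u`, tightness yields an instance whose ratio is above `u`.
        (no  ρ≰u) → uncurry
          (λ i ρ-ε<ratio → contradiction (ratio≤u i) (<⇒≱ (begin-strict
            u                   ≈⟨ x≈y-[y-x] u (R / K) ⟩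
            R / K - (R / K - u) <⟨ ρ-ε<ratio ⟩
            ratio P i           ∎)))
          (tight (R / K - u) (x<y⇒0<y-x (≰⇒> ρ≰u)))
    }

theorem2 : ∀ {c ℓ₁ ℓ₂} (F : ArchimedeanOrderedField c ℓ₁ ℓ₂) (P : Parameters F) →
    let open ArchimedeanOrderedField F
        open Parameters P
        ρ = (L * Pmax) / (L * cₒ + cₘ)
    in IsSupremum (ratio P) ρ × Tight P ρ
theorem2 F P = Tightness.supremum P , Tightness.tight P
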